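{- Let $\kappa$ be a regular uncountable cardinal and $\lambda>\kappa$ a cardinal. Suppose that $\kappa$ is a limit cardinal and $H$ is an ideal on $P_\kappa(\lambda)$ such that $\mathrm{cof}(H)<\mathbf{cov}(\mathbf{M}_{\kappa,\kappa})$. Then $H^+\xrightarrow{\kappa}[H^+]^2_{\kappa^+}$.
   Context: For a cardinal $\mu$ and a set $A$, $P_\mu(A)=\{a\subseteq A:|a|<\mu\}$. An ideal on an infinite set $S$ is a collection $K$ of subsets of $S$ containing all singletons, closed under subsets and finite unions, with $S\notin K$; $K^+=P(S)\setminus K$; $\mathrm{cof}(K)$ is the least cardinality of an $X\subseteq K$ with $K=\bigcup_{A\in X}P(A)$. $I_{\kappa,\lambda}$ is the set of all $A\subseteq P_\kappa(\lambda)$ such that $A\cap\{b\in P_\kappa(\lambda):a\subseteq b\}=\emptyset$ for some $a\in P_\kappa(\lambda)$. "Ideal on $P_\kappa(\lambda)$" always means an ideal $H$ on $P_\kappa(\lambda)$ that is $\kappa$-complete (closed under unions of fewer than $\kappa$ members) and fine ($I_{\kappa,\lambda}\subseteq H$). For $A\subseteq P_\kappa(\lambda)$, $[A]^2_\kappa=\{(\bigcup(a\cap\kappa),b):a,b\in A,\ \bigcup(a\cap\kappa)<\bigcup(b\cap\kappa)\}$. For a cardinal $\rho$ with $2\le\rho\le\lambda^{<\kappa}$ and an ideal $H$ on $P_\kappa(\lambda)$, $H^+\xrightarrow{\kappa}[H^+]^2_\rho$ means: for every $F:[P_\kappa(\lambda)]^2_\kappa\to\rho$ and every $A\in H^+$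 there is $B\in H^+\cap P(A)$ such that $F''[B]^2_\kappa\ne\rho$. $\mathbf{cov}(\mathbf{M}_{\kappa,\kappa})$: give ${}^\kappa2$ the topology whose basic open sets are $\emptyset$ and $O_s=\{f\in{}^\kappa2:s\subseteq f\}$ for $s\in\bigcup\{{}^a2:a\in P_\kappa(\kappa)\}$. $\mathbf{M}_{\kappa,\kappa}$ is the set of all $W\subseteq{}^\kappa2$ such that $W\cap\bigcap X=\emptyset$ for some collection $X$ of dense open sets with $0<|X|\le\kappa$. $\mathbf{cov}(\mathbf{M}_{\kappa,\kappa})$ is the least cardinality of a $Y\subseteq\mathbf{M}_{\kappa,\kappa}$ with $\bigcup Y={}^\kappa2$. -}

module Defs where

open import Data.Bool.Base using (Bool; T)
open import Data.Nat.Base using (ℕ)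
open import Data.Product.Base using (∃; ∃-syntax; _×_; _,_; proj₁; proj₂)
open import Data.Refinement using (Refinement-syntax; value)
open import Data.Refinement.Properties using (value-injective)
open import Data.Sum.Base using (_⊎_)
open import Function.Base using (_∘_; _on_)
open import Function.Bundles using (_↣_; _↔_; _⇔_)
open import Induction.WellFounded using (WellFounded)
open import Level using (0ℓ)
open import Relation.Binary.Core using (Rel)
open import Relation.Binary.Definitions using (Trichotomous; tri<; tri≈; tri>)
open import Relation.Binary.PropositionalEquality.Core using (_≡_; cong)
open import Relation.Binary.PropositionalEquality.Properties using (isEquivalence)
open import Relation.Binary.Structures using (IsStrictTotalOrder)
open import Relation.Nullary.Negation.Core using (¬_)
open import Relation.Unary using (Pred; _∈_; _∉_; _⊆_; _≐_; _∪_; _∩_; U; ｛_｝; Empty; Satisfiable; Universal)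
import Relation.Binary.Construct.On as On

-- The definitions are meant to be read in a classical metatheory (excluded
-- middle for all types in Set, and function extensionality).  Since Dec P
-- carries an element of P, excluded middle also yields choice functions.  In
-- this setting A → Bool is the full power set of A; unlike Pred A 0ℓ it stays
-- in Set, so that power sets can be iterated and have cardinalities.

ℙ : Set → Set
ℙ A = A → Bool

El : {A : Set} → ℙ A → Pred A 0ℓ
El X = T ∘ X

⟦_⟧ : {A : Set} → ℙ A → Set
⟦ X ⟧ = ∃ (El X)

-- The union of a collection of subsets.  A subset given by a formula, as here,
-- is only a Pred; that some X : ℙ A is this subset is expressed by El X ≐_.

⋃ : {A : Set} → ℙ (ℙ A) → Pred A 0ℓ
⋃ 𝒳 x = ∃[ X ] X ∈ El 𝒳 × x ∈ El X

⋂ : {A : Set} → ℙ (ℙ A) → Pred A 0ℓ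
⋂ 𝒳 x = ∀ X → X ∈ El 𝒳 → x ∈ El X

infix 4 _≼_ _≺_

_≼_ : Set → Set → Set
A ≼ B = A ↣ B

_≺_ : Set → Set → Set
A ≺ B = A ≼ B × ¬ (B ≼ A)

-- An ordinal is presented as a well-ordered type, whose elements play the role
-- of the smaller ordinals.

record Ordinal : Set₁ where
  field
    Carrier            : Set
    _<_                : Rel Carrier 0ℓ
    isStrictTotalOrder : IsStrictTotalOrder _≡_ _<_
    wellFounded        : WellFounded _<_

∣_∣ : Ordinal → Set
∣_∣ = Ordinal.Carrier

-- α ↾ ξ is the element ξ of α regarded as an ordinal, {η | η < ξ}.

infixl 8 _↾_

_↾_ : (α : Ordinal) → ∣ α ∣ → Ordinal
α ↾ ξ = record
  { Carrier            = [ η ∈ ∣ α ∣ ∣ η < ξ ]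
  ; _<_                = _<_ on value
  ; isStrictTotalOrder = record
    { isStrictPartialOrder = record
      { isEquivalence = isEquivalence
      ; irrefl        = λ x≡y → irrefl (cong value x≡y)
      ; trans         = trans
      ; <-resp-≈      = (λ { _≡_.refl p → p }) , (λ { _≡_.refl p → p })
      }
    ; compare = compare′
    }
  ; wellFounded        = On.wellFounded value wellFounded
  }
  where
  open Ordinal α
  open IsStrictTotalOrder isStrictTotalOrder using (irrefl; trans; compare)

  compare′ : Trichotomous {A = [ η ∈ ∣ α ∣ ∣ η < ξ ]} _≡_ (_<_ on value)
  compare′ x y with compare (value x) (value y)
  ... | tri< p q r = tri< p (q ∘ cong value) r
  ... | tri≈ p q r = tri≈ p (value-injective q) r
  ... | tri> p q r = tri> p (q ∘ cong value) r

-- A cardinal is an initial ordinal.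

IsCardinal : Ordinal → Set
IsCardinal α = ∀ ξ → ∣ α ↾ ξ ∣ ≺ ∣ α ∣

IsUncountable : Ordinal → Set
IsUncountable α = ℕ ≺ ∣ α ∣

IsCofinal : (α : Ordinal) → ℙ ∣ α ∣ → Set
IsCofinal α X = ∀ ξ → ∃[ η ] η ∈ El X × (ξ < η ⊎ ξ ≡ η)
  where open Ordinal α

-- For an infinite cardinal κ: cf(κ) = κ.

IsRegular : Ordinal → Set
IsRegular κ = ∀ X → IsCofinal κ X → ∣ κ ∣ ≼ ⟦ X ⟧

-- For an infinite cardinal κ: there is no largest cardinality below κ.

IsLimitCardinal : Ordinal → Set
IsLimitCardinal κ = ∀ ξ → ∃[ η ] ∣ κ ↾ ξ ∣ ≺ ∣ κ ↾ η ∣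

record IsCardinalSuccessor (κ κ⁺ : Ordinal) : Set₁ where
  field
    isCardinal : IsCardinal κ⁺
    greater    : ∣ κ ∣ ≺ ∣ κ⁺ ∣
    least      : ∀ μ → IsCardinal μ → ∣ κ ∣ ≺ ∣ μ ∣ → ∣ κ⁺ ∣ ≼ ∣ μ ∣

-- μ is the least cardinality of a subset of A satisfying Φ.

record IsLeastCardinality {A : Set} (Φ : Pred (ℙ A) 0ℓ) (μ : Ordinal) : Set where
  field
    isCardinal : IsCardinal μ
    attained   : ∃[ X ] X ∈ Φ × (∣ μ ∣ ↔ ⟦ X ⟧)
    least      : ∀ X → X ∈ Φ → ∣ μ ∣ ≼ ⟦ X ⟧

-- P< μ A is P_μ(A).

P< : Ordinal → Set → Set
P< μ A = [ a ∈ ℙ A ∣ ⟦ a ⟧ ≺ ∣ μ ∣ ]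

record IsIdeal {S : Set} (K : ℙ (ℙ S)) : Set where
  field
    singletons : ∀ s {X} → El X ≐ ｛ s ｝ → X ∈ El K
    subsets    : ∀ {X Y} → El X ⊆ El Y → Y ∈ El K → X ∈ El K
    unions     : ∀ {X Y Z} → X ∈ El K → Y ∈ El K → El Z ≐ El X ∪ El Y → Z ∈ El K
    proper     : ∀ {X} → Universal (El X) → X ∉ El K

infix 10 _⁺

_⁺ : {S : Set} → ℙ (ℙ S) → Pred (ℙ S) 0ℓ
(K ⁺) X = X ∉ El K

IsComplete : Ordinal → {S : Set} → ℙ (ℙ S) → Set
IsComplete κ K = ∀ 𝒳 → El 𝒳 ⊆ El K → ⟦ 𝒳 ⟧ ≺ ∣ κ ∣ → ∀ Z → El Z ≐ ⋃ 𝒳 → Z ∈ El K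

-- 𝒳 ⊆ K and K is the union of the P(A) for A ∈ 𝒳.

Generates : {S : Set} → ℙ (ℙ S) → Pred (ℙ (ℙ S)) 0ℓ
Generates K 𝒳 = El 𝒳 ⊆ El K × El K ≐ (λ B → ∃[ A ] A ∈ El 𝒳 × El B ⊆ El A)

IsCof : {S : Set} → ℙ (ℙ S) → Ordinal → Set
IsCof K = IsLeastCardinality (Generates K)

-- Here κ is an element of the ordinal Λ, that is, an ordinal κ < Λ.

module _ (Λ : Ordinal) (κ : ∣ Λ ∣) where

  open Ordinal Λ using (_<_)

  Pκ : Set
  Pκ = P< (Λ ↾ κ) ∣ Λ ∣

  -- I_{κ,λ}, with Λ for λ

  I : Pred (ℙ Pκ) 0ℓ
  I A = ∃ λ (a : Pκ) → Empty (El A ∩ λ b → El (value a) ⊆ El (value b))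

  record IsIdealOnPκ (H : ℙ (ℙ Pκ)) : Set where
    field
      isIdeal    : IsIdeal H
      isComplete : IsComplete (Λ ↾ κ) H
      isFine     : I ⊆ El H

  -- δ = ⋃(a ∩ κ) for von Neumann ordinals: the elements of δ are the ordinals
  -- belonging to some η ∈ a with η < κ.

  IsTrace : Pκ → ∣ Λ ∣ → Set
  IsTrace a δ = ∀ ξ → ξ < δ ⇔ (∃[ η ] η ∈ El (value a) × η < κ × ξ < η)

  -- [A]²_κ

  Pairs : Pred Pκ 0ℓ → Pred (∣ Λ ∣ × Pκ) 0ℓ
  Pairs A (δ , b) = b ∈ A × ∃[ a ] a ∈ A × IsTrace a δ × (∃[ ε ] IsTrace b ε × δ < ε)

  AllPairs : Set
  AllPairs = [ p ∈ ∣ Λ ∣ × Pκ ∣ p ∈ Pairs U ]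

  -- F″[A]²_κ

  Image : {ρ : Set} → (AllPairs → ρ) → ℙ Pκ → Pred ρ 0ℓ
  Image F A c = ∃[ p ] value p ∈ Pairs (El A) × F p ≡ c

  -- H⁺ →κ [H⁺]²_ρ

  PartitionRelation : ℙ (ℙ Pκ) → Ordinal → Set
  PartitionRelation H ρ =
    (F : AllPairs → ∣ ρ ∣) → ∀ A → A ∈ H ⁺ →
    ∃[ B ] B ∈ H ⁺ × El B ⊆ El A × ¬ Universal (Image F B)

module _ (κ : Ordinal) where

  2^ : Set
  2^ = ∣ κ ∣ → Bool

  -- O_s for the partial function s with domain a

  O : (a : P< κ ∣ κ ∣) → (⟦ value a ⟧ → Bool) → Pred 2^ 0ℓ
  O a s f = ∀ x → f (proj₁ x) ≡ s x

  IsOpen : Pred (ℙ 2^) 0ℓ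
  IsOpen W = ∀ f → f ∈ El W → ∃[ a ] ∃[ s ] f ∈ O a s × O a s ⊆ El W

  IsDense : Pred (ℙ 2^) 0ℓ
  IsDense W = ∀ V → IsOpen V → Satisfiable (El V) → Satisfiable (El V ∩ El W)

  -- M_{κ,κ}

  M : Pred (ℙ 2^) 0ℓ
  M W = ∃[ 𝒳 ] El 𝒳 ⊆ (IsOpen ∩ IsDense) × Satisfiable (El 𝒳) × ⟦ 𝒳 ⟧ ≼ ∣ κ ∣ × Empty (El W ∩ ⋂ 𝒳)

  -- ν is cov(M_{κ,κ}).

  IsCovM : Ordinal → Set
  IsCovM = IsLeastCardinality (λ 𝒴 → El 𝒴 ⊆ M × Universal (⋃ 𝒴))

{-# OPTIONS --safe #-}

-- Write tr b for ⋃(b ∩ κ).  Call a colour c avoidable if for every γ < κ the set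
-- of all b ∈ A such that F(δ , b) ≠ c for all δ < γ is in H⁺.
--
-- Some colour is avoidable: otherwise there is a single γ that witnesses the
-- failure for κ many colours.  As κ is a limit cardinal, more than |γ|, but fewer
-- than κ of these colours can be chosen, and since H is κ-complete some b ∈ A
-- attains all of them on pairs (δ , b) with δ < γ, which is absurd.
--
-- If c is avoidable, then for every C ∈ H the set of all f ∈ 2^κ for which
--   B_f = {b ∈ A : f(tr b) = 1 and F(δ , b) ≠ c whenever δ < tr b and f(δ) = 1}
-- is not included in C is open and dense.  By the hypothesis on cof(H), some f
-- lies in these sets for all C in a generating family, so that B_f ∈ H⁺; and c is
-- not attained on [B_f]²_κ.

module Submission where

open import Defs
open import Level using (0ℓ)
open import Axiom.ExcludedMiddle using (ExcludedMiddle)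
open import Axiom.Extensionality.Propositional using (Extensionality)

open import Data.Bool.Base using (true; false; T)
open import Data.Bool.Properties using (T-irrelevant)
open import Data.Empty using (⊥-elim)
open import Data.Irrelevant using ([_])
open import Data.Nat.Properties using (0≢1+n)
open import Data.Product.Base using (∃; ∃-syntax; _×_; _,_; proj₁; proj₂)
open import Data.Product.Relation.Binary.Lex.Strict using (×-Lex; ×-wellFounded; ×-compare)
open import Data.Refinement using (Refinement-syntax; value; _,_)
open import Data.Refinement.Properties using (value-injective)
open import Data.Sum.Base using (_⊎_; inj₁; inj₂)
open import Data.Unit.Base using (⊤; tt)
open import Function.Base using (_∘_; _on_)
open import Function.Bundles using (_↣_; mk↣; mk⇔; module Injection; module Equivalence)
open import Function.Construct.Composition using (_↣-∘_)
open import Function.Properties.Inverse using (↔⇒↣; ↔-sym)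
open import Induction.WellFounded using (WellFounded; WfRec; module FixPoint; module All)
open import Relation.Binary.Core using (Rel)
open import Relation.Binary.Definitions using (tri<; tri≈; tri>)
open import Relation.Binary.PropositionalEquality using (_≡_; _≢_; refl; sym; trans; cong; subst)
open import Relation.Binary.Structures using (IsStrictTotalOrder)
open import Relation.Nullary.Decidable using (isYes; toWitness; fromWitness; decidable-stable; recompute)
open import Relation.Nullary.Negation using (¬_; contradiction)
open import Relation.Unary using (Pred; _∈_; _∉_; _⊆_; _≐_; _∩_; ｛_｝; Satisfiable; Universal)
import Relation.Binary.Construct.On as On

-- Injections, power sets and ordinals.

private variable
  A B C : Set

≼-trans : A ≼ B → B ≼ C → A ≼ C
≼-trans f g = g ↣-∘ f

≼-≺-trans : A ≼ B → B ≺ C → A ≺ C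
≼-≺-trans f (g , ¬h) = ≼-trans f g , λ h → ¬h (≼-trans h f)

surjection⇒≼ : (f : A → B) → (∀ y → ∃[ x ] f x ≡ y) → B ≼ A
surjection⇒≼ f s = mk↣ {to = proj₁ ∘ s} λ {x} {y} e →
  trans (sym (proj₂ (s x))) (trans (cong f e) (proj₂ (s y)))

⟦⟧-≡ : {X : ℙ A} {x y : ⟦ X ⟧} → proj₁ x ≡ proj₁ y → x ≡ y
⟦⟧-≡ {x = x , p} {y = _ , q} refl = cong (x ,_) (T-irrelevant p q)

T-injective : ∀ {x y} → (T x → T y) → (T y → T x) → x ≡ y
T-injective {true}  {true}  f g = refl
T-injective {true}  {false} f g = ⊥-elim (f tt)
T-injective {false} {true}  f g = ⊥-elim (g tt)
T-injective {false} {false} f g = refl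

module _ (α : Ordinal) where

  open Ordinal α
  open IsStrictTotalOrder isStrictTotalOrder using (compare) renaming (trans to <-trans)

  ≤-<-trans : ∀ {ξ η ζ} → ¬ (η < ξ) → η < ζ → ξ < ζ
  ≤-<-trans {ξ} {η} η≮ξ η<ζ with compare ξ η
  ... | tri< ξ<η _ _  = <-trans ξ<η η<ζ
  ... | tri≈ _ refl _ = η<ζ
  ... | tri> _ _ η<ξ  = contradiction η<ξ η≮ξ

  <-≤-trans : ∀ {ξ η ζ} → ξ < η → ¬ (ζ < η) → ξ < ζ
  <-≤-trans {ξ} {η} {ζ} ξ<η ζ≮η with compare η ζ
  ... | tri< η<ζ _ _  = <-trans ξ<η η<ζ
  ... | tri≈ _ refl _ = ξ<η
  ... | tri> _ _ ζ<η  = contradiction ζ<η ζ≮η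

  ↾≼ : ∀ {ξ} → ∣ α ↾ ξ ∣ ≼ ∣ α ∣
  ↾≼ = mk↣ {to = value} value-injective

-- Classical logic and comprehension.

module _ (em : ExcludedMiddle 0ℓ) where

  dne : {P : Set} → ¬ ¬ P → P
  dne = decidable-stable em

  ¬∀⇒∃¬ : {P : Pred A 0ℓ} → ¬ (∀ x → P x) → ∃[ x ] ¬ P x
  ¬∀⇒∃¬ ¬∀ = dne λ ¬∃ → ¬∀ λ x → dne λ ¬p → ¬∃ (x , ¬p)

  ⊈⇒∃ : {P Q : Pred A 0ℓ} → ¬ (P ⊆ Q) → ∃[ x ] x ∈ P × x ∉ Q
  ⊈⇒∃ P⊈Q = dne λ ¬∃ → P⊈Q λ p → dne λ ¬q → ¬∃ (_ , p , ¬q)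

  -- The proof stored in a refinement is irrelevant; excluded middle recovers a usable one.
  holds : {P : Pred A 0ℓ} (x : [ x ∈ A ∣ P x ]) → P (value x)
  holds (_ , [ p ]) = recompute em p

  -- Abstract, so that P can be inferred from El (comp P) x.
  abstract
    comp : Pred A 0ℓ → ℙ A
    comp P x = isYes (em {P x})

    ∈comp⁻ : {P : Pred A 0ℓ} → El (comp P) ⊆ P
    ∈comp⁻ = toWitness

    ∈comp⁺ : {P : Pred A 0ℓ} → P ⊆ El (comp P)
    ∈comp⁺ = fromWitness

  ≐comp : {P : Pred A 0ℓ} → El (comp P) ≐ P
  ≐comp = ∈comp⁻ , ∈comp⁺

  ran : (A → B) → ℙ B
  ran f = comp λ y → ∃[ x ] f x ≡ y

  ran≼ : (f : A → B) → ⟦ ran f ⟧ ≼ A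
  ran≼ f = surjection⇒≼ (λ x → f x , ∈comp⁺ (x , refl)) λ (_ , p) →
    let x , e = ∈comp⁻ p in x , ⟦⟧-≡ e

  -- Bounded sets and initial segments of a cardinal.

  module _ (α : Ordinal) where

    open Ordinal α
    open IsStrictTotalOrder isStrictTotalOrder using (compare)

    minimal : (P : Pred ∣ α ∣ 0ℓ) → Satisfiable P → ∃[ ξ ] ξ ∈ P × (∀ η → η < ξ → η ∉ P)
    minimal P (ξ , p) = dne λ ¬∃ →
      All.wfRec wellFounded 0ℓ (_∉ P)
        (λ ξ ih ξ∈P → ¬∃ (ξ , ξ∈P , λ η → ih)) ξ p

    -- A set without a strict upper bound is cofinal, so regularity makes it large.
    small⇒bounded : IsRegular α → ∀ X → ¬ (∣ α ∣ ≼ ⟦ X ⟧) → ∃[ γ ] (∀ η → η ∈ El X → η < γ)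
    small⇒bounded reg X ¬≼ with ¬∀⇒∃¬ (¬≼ ∘ reg X)
    ... | γ , ¬above = γ , below
      where
      below : ∀ η → η ∈ El X → η < γ
      below η η∈X with compare γ η
      ... | tri< γ<η _ _  = contradiction (η , η∈X , inj₁ γ<η) ¬above
      ... | tri≈ _ γ≡η _  = contradiction (η , η∈X , inj₂ γ≡η) ¬above
      ... | tri> _ _ η<γ  = η<γ

    ≺⇒< : ∀ {ξ η} → ∣ α ↾ ξ ∣ ≺ ∣ α ↾ η ∣ → ξ < η
    ≺⇒< {ξ} {η} (_ , ¬≽) = dne λ ξ≮η → ¬≽
      (mk↣ {to = λ (ζ , [ ζ<η ]) → ζ , [ <-≤-trans α ζ<η ξ≮η ]}
        λ e → value-injective (cong value e))

    -- The limit hypothesis gives some `ε′` above `ε`, so the closed segment embeds into a proper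
    -- initial segment of a cardinal.
    ≤-segment≺ : IsCardinal α → IsLimitCardinal α → ∀ ε → ⟦ comp (λ δ → ¬ (ε < δ)) ⟧ ≺ ∣ α ∣
    ≤-segment≺ card lim ε with lim ε
    ... | ε′ , ε≺ε′ = ≼-≺-trans
      (mk↣ {to = λ (δ , p) → δ , [ ≤-<-trans α (∈comp⁻ p) (≺⇒< ε≺ε′) ]} (⟦⟧-≡ ∘ cong value))
      (card ε′)

  -- Injections by well-founded recursion.

  module _ (ext : Extensionality 0ℓ 0ℓ) where

    -- An injection is defined by recursion on s, choosing for s an element of B
    -- that is not yet the image of a predecessor of s.
    segments⇒≼ : {_<_ : Rel A 0ℓ} → WellFounded _<_ → (∀ x y → x ≢ y → x < y ⊎ y < x) →
                 (∀ s → ¬ (B ≼ [ t ∈ A ∣ t < s ])) → A ≼ B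
    segments⇒≼ {A} {B} {_<_} wf connex ¬≼ = mk↣ {to = g} g-injective
      where
      fresh : ∀ s (h : [ t ∈ A ∣ t < s ] → B) → ∃[ y ] ¬ (∃[ t ] h t ≡ y)
      fresh s h = ¬∀⇒∃¬ (¬≼ s ∘ surjection⇒≼ h)

      step : ∀ s → WfRec _<_ (λ _ → B) s → B
      step s ih = proj₁ (fresh s λ (t , [ t<s ]) → ih (recompute em t<s))

      open All wf 0ℓ using (wfRec)
      open FixPoint wf (λ _ → B) step
        (λ s ih≡ → cong (proj₁ ∘ fresh s) (ext λ (t , [ t<s ]) → ih≡ (recompute em t<s)))
        using (unfold-wfRec)

      g : A → B
      g = wfRec (λ _ → B) step

      g-≢ : ∀ {s t} → t < s → g t ≢ g s
      g-≢ {s} {t} t<s e = proj₂ (fresh s λ (t , _) → g t) ((t , [ t<s ]) , trans e unfold-wfRec)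

      g-injective : ∀ {s t} → g s ≡ g t → s ≡ t
      g-injective {s} {t} e = dne λ s≢t → case (connex s t s≢t)
        where
        case : ¬ (s < t ⊎ t < s)
        case (inj₁ s<t) = g-≢ s<t e
        case (inj₂ t<s) = g-≢ t<s (sym e)

    -- Ordering ρ by rank first, all proper initial segments of ρ would otherwise
    -- have fewer than |K| elements.
    rank-concentrated : (K ρ : Ordinal) → ¬ (∣ ρ ∣ ≼ ∣ K ∣) → (rank : ∣ ρ ∣ → ∣ K ∣) →
                        ∃[ γ ] ∣ K ∣ ≼ [ c ∈ ∣ ρ ∣ ∣ ¬ Ordinal._<_ K γ (rank c) ]
    rank-concentrated K ρ ρ⋠K rank = dne λ ¬∃ → ρ⋠K
      (segments⇒≼ (On.wellFounded key (×-wellFounded K.wellFounded ρ.wellFounded)) connex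
        λ s K≼ → ¬∃ (rank s , ≼-trans K≼ (mk↣ {to = λ (t , [ t<s ]) → t , [ rank≤ t<s ]}
                                              (λ e → value-injective (cong value e)))))
      where
      module K = Ordinal K
      module ρ = Ordinal ρ
      module K′ = IsStrictTotalOrder K.isStrictTotalOrder
      module ρ′ = IsStrictTotalOrder ρ.isStrictTotalOrder

      key : ∣ ρ ∣ → ∣ K ∣ × ∣ ρ ∣
      key c = rank c , c

      _<ₖ_ : Rel ∣ ρ ∣ 0ℓ
      _<ₖ_ = ×-Lex _≡_ K._<_ ρ._<_ on key

      connex : ∀ c d → c ≢ d → c <ₖ d ⊎ d <ₖ c
      connex c d c≢d with ×-compare sym K′.compare ρ′.compare (key c) (key d)
      ... | tri< c<d _ _   = inj₁ c<d
      ... | tri≈ _ (_ , e) _ = contradiction e c≢d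
      ... | tri> _ _ d<c   = inj₂ d<c

      rank≤ : ∀ {c d} → c <ₖ d → ¬ (rank d K.< rank c)
      rank≤ (inj₁ c<d)     d<c = K′.irrefl refl (K′.trans c<d d<c)
      rank≤ (inj₂ (e , _)) d<c = K′.irrefl (sym e) d<c

  -- Positive sets of an ideal, and generic points of 2^κ.

  module _ {S : Set} {H : ℙ (ℙ S)} (ideal : IsIdeal H) where

    open IsIdeal ideal

    positive-∖ : ∀ {X C} → X ∈ H ⁺ → C ∈ El H → ∃[ s ] s ∈ El X × s ∉ El C
    positive-∖ X∈H⁺ C∈H = ⊈⇒∃ λ X⊆C → X∈H⁺ (subsets X⊆C C∈H)

    positive-∖∖ : ∀ {X C D} → X ∈ H ⁺ → C ∈ El H → D ∈ El H → ∃[ s ] s ∈ El X × s ∉ El C × s ∉ El D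
    positive-∖∖ X∈H⁺ C∈H D∈H with positive-∖ X∈H⁺ (unions C∈H D∈H ≐comp)
    ... | s , s∈X , s∉ = s , s∈X , s∉ ∘ ∈comp⁺ ∘ inj₁ , s∉ ∘ ∈comp⁺ ∘ inj₂

  -- If no `f` were in every `W j`, the complements would cover 2^κ. Each complement is in `M K`,
  -- witnessed by one open dense set, and there are at most `μ` of them, fewer than the covering
  -- number.
  ∃-generic : (K : Ordinal) → ∣ K ∣ → {J : Set} (μ ν : Ordinal) → J ≼ ∣ μ ∣ → IsCovM K ν → ∣ μ ∣ ≺ ∣ ν ∣ →
            (W : J → ℙ (2^ K)) → (∀ j → W j ∈ IsOpen K ∩ IsDense K) →
            ∃[ f ] (∀ j → f ∈ El (W j))
  ∃-generic K ξ₀ {J} μ ν J≼μ covM (_ , ν⋠μ) W W-dense =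
    let f , f∉ = ¬∀⇒∃¬ (¬covers)
    in f , λ j → dne λ f∉W → f∉ (co j , ∈comp⁺ (j , refl) , ∈comp⁺ f∉W)
    where
    co : J → ℙ (2^ K)
    co j = comp (_∉ El (W j))

    co-meagre : ∀ j → co j ∈ M K
    co-meagre j =
        ran (λ (_ : ⊤) → W j)
      , (λ p → let _ , e = ∈comp⁻ p in subst (_∈ IsOpen K ∩ IsDense K) e (W-dense j))
      , (W j , ∈comp⁺ (tt , refl))
      , ≼-trans (ran≼ _) (mk↣ {to = λ _ → ξ₀} λ _ → refl)
      , λ f (f∈co , f∈⋂) → ∈comp⁻ f∈co (f∈⋂ (W j) (∈comp⁺ (tt , refl)))

    ¬covers : ¬ Universal (⋃ (ran co))
    ¬covers cover = ν⋠μ (≼-trans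
      (IsLeastCardinality.least covM (ran co)
        ((λ p → let j , e = ∈comp⁻ p in subst (_∈ M K) e (co-meagre j)) , cover))
      (≼-trans (ran≼ co) J≼μ))

  -- Existence of an avoidable colour.

  -- In the application R ξ s c says that the pair (ξ , s) has colour c; the
  -- colouring is a relation since only some pairs are coloured.
  module _ (ext : Extensionality 0ℓ 0ℓ) (K : Ordinal) (K-card : IsCardinal K) (K-lim : IsLimitCardinal K)
           {S : Set} {H : ℙ (ℙ S)} (ideal : IsIdeal H) (complete : IsComplete K H)
           (ρ : Ordinal) (ρ⋠K : ¬ (∣ ρ ∣ ≼ ∣ K ∣))
           (R : ∣ K ∣ → S → ∣ ρ ∣ → Set) (R-functional : ∀ {ξ s c d} → R ξ s c → R ξ s d → c ≡ d)
           (A : ℙ S) (A∈H⁺ : A ∈ H ⁺) where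

    open Ordinal K
    open IsIdeal ideal
    open IsStrictTotalOrder isStrictTotalOrder using (irrefl) renaming (trans to <-trans)

    avoiding : ∣ ρ ∣ → ∣ K ∣ → ℙ S
    avoiding c γ = comp λ s → s ∈ El A × (∀ ξ → ξ < γ → ¬ R ξ s c)

    avoiding-antitone : ∀ {c γ δ} → ¬ (δ < γ) → El (avoiding c δ) ⊆ El (avoiding c γ)
    avoiding-antitone δ≮γ p =
      let s∈A , no-c = ∈comp⁻ p in ∈comp⁺ (s∈A , λ ξ ξ<γ → no-c ξ (<-≤-trans K ξ<γ δ≮γ))

    -- By completeness the union of fewer than κ sets in `H` is in `H`, so some `s` in `A` lies
    -- outside it. This `s` attains each of the colours at some ξ < `γ`, and distinct colours need
    -- distinct ξ.
    few-avoided : ∀ {γ η} (colour : ∣ K ↾ η ∣ ↣ ∣ ρ ∣) → (∀ t → avoiding (Injection.to colour t) γ ∈ El H) →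
                  ∣ K ↾ η ∣ ≼ ∣ K ↾ γ ∣
    few-avoided {γ} {η} colour avoiding∈H = few (positive-∖ ideal A∈H⁺ ⋃𝒵∈H)
      where
      open Injection colour using (to; injective)

      𝒵 : ℙ (ℙ S)
      𝒵 = ran λ t → avoiding (to t) γ

      ⋃𝒵∈H : comp (⋃ 𝒵) ∈ El H
      ⋃𝒵∈H = complete 𝒵 (λ p → let t , e = ∈comp⁻ p in subst (_∈ El H) e (avoiding∈H t))
        (≼-≺-trans (ran≼ _) (K-card η)) _ ≐comp

      few : ∃[ s ] s ∈ El A × s ∉ El (comp (⋃ 𝒵)) → ∣ K ↾ η ∣ ≼ ∣ K ↾ γ ∣
      few (s , s∈A , s∉) = mk↣ {to = λ t → proj₁ (attains t) , [ proj₁ (proj₂ (attains t)) ]}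
        λ {t} {u} e → injective (R-functional (proj₂ (proj₂ (attains t)))
          (subst (λ ξ → R ξ s (to u)) (sym (cong value e)) (proj₂ (proj₂ (attains u)))))
        where
        attains : ∀ t → ∃[ ξ ] ξ < γ × R ξ s (to t)
        attains t = dne λ ¬∃ → s∉ (∈comp⁺
          ( avoiding (to t) γ , ∈comp⁺ (t , refl)
          , ∈comp⁺ (s∈A , λ ξ ξ<γ r → ¬∃ (ξ , ξ<γ , r))))

    ∃-avoidable : ∃[ c ] (∀ γ → avoiding c γ ∈ H ⁺)
    ∃-avoidable = dne λ ¬∃ → absurd λ c →
      let γ , ¬pos = ¬∀⇒∃¬ (λ pos → ¬∃ (c , pos)) in γ , dne ¬pos
      where
      absurd : ¬ (∀ c → ∃[ γ ] avoiding c γ ∈ El H)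
      absurd bad =
        let γ , K≼bad    = rank-concentrated ext K ρ ρ⋠K (proj₁ ∘ bad)
            -- `η` is chosen of larger cardinality than `γ`; the κ many bad colours supply a
            -- distinct one for each element of `η`.
            η , _ , η⋠γ  = K-lim γ
            colours      = ≼-trans (↾≼ K) K≼bad
        in η⋠γ (few-avoided (≼-trans colours (mk↣ {to = value} value-injective)) λ t →
             let c = Injection.to colours t
             -- Each colour fails at its own bound, which is at most `γ`; raising the bound to `γ`
             -- only shrinks the set.
             in subsets (avoiding-antitone (holds c)) (proj₂ (bad (value c))))

    -- A positive set from a generic function.

    module _ (c : ∣ ρ ∣) (avoidable : ∀ γ → avoiding c γ ∈ H ⁺)
             (ξ₀ : ∣ K ∣) (K-reg : IsRegular K) (tr : S → ∣ K ∣) (bounded∈H : ∀ γ → comp (λ s → ¬ (γ < tr s)) ∈ El H)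
             (μ ν : Ordinal) (cof : IsCof H μ) (covM : IsCovM K ν) (μ≺ν : ∣ μ ∣ ≺ ∣ ν ∣) where

      Selects : 2^ K → Pred S 0ℓ
      Selects f s = s ∈ El A × tr s ∈ El f × (∀ ξ → ξ < tr s → ξ ∈ El f → ¬ R ξ s c)

      escaping : ℙ S → ℙ (2^ K)
      escaping C = comp λ f → ∃[ s ] s ∉ El C × s ∈ Selects f

      -- Whether `f` selects a fixed `s` depends only on the values of `f` at all δ ≤ `tr s`. The
      -- point `tr s` itself must be in the domain, since `f` has to be 1 there.
      escaping-open : ∀ C → escaping C ∈ IsOpen K
      escaping-open C f f∈ with ∈comp⁻ f∈
      ... | s , s∉C , s∈A , tr∈f , sel =
          (comp (λ δ → ¬ (tr s < δ)) , [ ≤-segment≺ K K-card K-lim (tr s) ])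
        , f ∘ proj₁
        , (λ _ → refl)
        , λ {g} g∈O → ∈comp⁺
            ( s , s∉C , s∈A
            , subst T (sym (g∈O (tr s , ∈comp⁺ (irrefl refl)))) tr∈f
            , λ ξ ξ<tr ξ∈g → sel ξ ξ<tr
                (subst T (g∈O (ξ , ∈comp⁺ λ tr<ξ → irrefl refl (<-trans ξ<tr tr<ξ))) ξ∈g))

      escaping-dense : ∀ {C} → C ∈ El H → escaping C ∈ IsDense K
      escaping-dense {C} C∈H V V-open (f , f∈V) with V-open f f∈V
      ... | (a , [ a≺K ]) , p , f∈O , O⊆V
        with small⇒bounded K K-reg a (proj₂ (recompute em a≺K))
      ... | γ , a<γ
        -- Beyond avoiding `C`, the witness `s` needs `tr s` above `γ`, so that setting the value
        -- there to 1 does not disturb the condition on `a`.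
        with positive-∖∖ ideal (avoidable γ) C∈H (bounded∈H γ)
      ... | s , s∈ , s∉C , s∉bd = g , O⊆V g∈O , ∈comp⁺
              ( s , s∉C , proj₁ (∈comp⁻ s∈) , ∈comp⁺ (inj₂ refl)
              , λ ξ ξ<tr ξ∈g → proj₂ (∈comp⁻ s∈) ξ (below ξ<tr (∈comp⁻ ξ∈g)))
        where
        g : 2^ K
        -- `g` follows `f` below `γ` and is 0 from `γ` on, except at `tr s`. So below `tr s` it is 1
        -- only at points below `γ`, where `s` avoids `c`.
        g = comp λ ξ → (ξ < γ × ξ ∈ El f) ⊎ ξ ≡ tr s

        γ<tr : γ < tr s
        γ<tr = dne (s∉bd ∘ ∈comp⁺)

        below : ∀ {ξ} → ξ < tr s → (ξ < γ × ξ ∈ El f) ⊎ ξ ≡ tr s → ξ < γ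
        below ξ<tr (inj₁ (ξ<γ , _)) = ξ<γ
        below ξ<tr (inj₂ ξ≡tr)      = contradiction ξ<tr (irrefl ξ≡tr)

        g∈O : g ∈ O K (a , [ a≺K ]) p
        g∈O x@(ξ , ξ∈a) = trans
          (T-injective (to ∘ ∈comp⁻) (λ ξ∈f → ∈comp⁺ (inj₁ (a<γ ξ ξ∈a , ξ∈f))))
          (f∈O x)
          where
          to : (ξ < γ × ξ ∈ El f) ⊎ ξ ≡ tr s → ξ ∈ El f
          to (inj₁ (_ , ξ∈f)) = ξ∈f
          to (inj₂ ξ≡tr)      = contradiction (<-trans (a<γ ξ ξ∈a) γ<tr) (irrefl ξ≡tr)

      ∃-avoiding : ∃[ B ] B ∈ H ⁺ × El B ⊆ El A ×
                   (∀ {r s} → r ∈ El B → s ∈ El B → tr r < tr s → ¬ R (tr r) s c)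
      ∃-avoiding with IsLeastCardinality.attained cof
      ... | 𝒳 , (𝒳⊆H , H≐) , μ↔𝒳
        with ∃-generic K ξ₀ μ ν (↔⇒↣ (↔-sym μ↔𝒳)) covM μ≺ν
               (escaping ∘ proj₁) (λ (C , C∈𝒳) → escaping-open C , escaping-dense (𝒳⊆H C∈𝒳))
      ... | f , f∈ =
          comp (Selects f)
        -- A set in `H` is covered by some generator `C`, but `f` selects a point outside `C`.
        , (λ B∈H → let C , C∈𝒳 , B⊆C = proj₁ H≐ B∈H
                       s , s∉C , sel = ∈comp⁻ (f∈ (C , C∈𝒳))
                   in s∉C (B⊆C (∈comp⁺ sel)))
        , proj₁ ∘ ∈comp⁻
        , λ r∈B s∈B r<s →
            proj₂ (proj₂ (∈comp⁻ s∈B)) _ r<s (proj₁ (proj₂ (∈comp⁻ r∈B)))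

  -- Traces of elements of P_κ(λ).

  module _ (Λ : Ordinal) (κ : ∣ Λ ∣) where

    open Ordinal Λ
    open IsStrictTotalOrder isStrictTotalOrder using (irrefl; compare) renaming (trans to <-trans)

    K : Ordinal
    K = Λ ↾ κ

    trace-≮ : ∀ {b δ ε} → IsTrace Λ κ b δ → IsTrace Λ κ b ε → ¬ (δ < ε)
    trace-≮ δ-trace ε-trace δ<ε =
      irrefl refl (Equivalence.from (δ-trace _) (Equivalence.to (ε-trace _) δ<ε))

    trace-unique : ∀ {b δ ε} → IsTrace Λ κ b δ → IsTrace Λ κ b ε → δ ≡ ε
    trace-unique {b} {δ} {ε} δ-trace ε-trace with compare δ ε
    ... | tri< δ<ε _ _ = contradiction δ<ε (trace-≮ {b} δ-trace ε-trace)
    ... | tri≈ _ δ≡ε _ = δ≡ε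
    ... | tri> _ _ ε<δ = contradiction ε<δ (trace-≮ {b} ε-trace δ-trace)

    -- By regularity b ∩ κ is bounded below κ; its least non-strict upper bound is the union.
    trace : IsRegular K → ∀ b → ∃[ ε ] IsTrace Λ κ b (value {P = _< κ} ε)
    trace reg (b , [ b≺κ ]) = supremum (small⇒bounded K reg b∩κ b∩κ-small)
      where
      b∩κ : ℙ ∣ K ∣
      b∩κ = b ∘ value

      b∩κ-small : ¬ (∣ K ∣ ≼ ⟦ b∩κ ⟧)
      b∩κ-small κ≼ = proj₂ (recompute em b≺κ) (≼-trans κ≼
        (mk↣ {to = λ (ξ , p) → value ξ , p} (⟦⟧-≡ ∘ value-injective ∘ cong proj₁)))

      Bound : Pred ∣ K ∣ 0ℓ
      Bound ε = ∀ η → η ∈ El b∩κ → ¬ (value ε < value η)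

      supremum : ∃[ γ ] (∀ η → η ∈ El b∩κ → value η < value γ) →
                 ∃[ ε ] IsTrace Λ κ (b , [ b≺κ ]) (value {P = _< κ} ε)
      supremum (γ , below)
        with minimal K Bound (γ , λ η η∈b γ<η → irrefl refl (<-trans γ<η (below η η∈b)))
      ... | ε@(_ , [ ε<κ ]) , bound , least = ε , λ ξ → mk⇔ (to ξ)
              λ (η , η∈b , η<κ , ξ<η) → <-≤-trans Λ ξ<η (bound (η , [ η<κ ]) η∈b)
        where
        to : ∀ ξ → ξ < value ε → ∃[ η ] η ∈ El b × η < κ × ξ < η
        to ξ ξ<ε = dne λ ¬∃ →
          least (ξ , [ <-trans ξ<ε (recompute em ε<κ) ]) ξ<ε
            λ (η , [ η<κ ]) η∈b ξ<η → ¬∃ (η , η∈b , recompute em η<κ , ξ<η)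

    -- Fineness applies to the singleton of some `γ′` with `γ` < `γ′` < κ: any `b` containing `γ′`
    -- has trace above `γ`.
    bounded-trace∈H : ∀ {H} → IsIdealOnPκ Λ κ H → IsUncountable K → IsLimitCardinal K →
                (tr : Pκ Λ κ → ∣ K ∣) → (∀ b → IsTrace Λ κ b (value (tr b))) →
                ∀ γ → comp (λ b → ¬ (value γ < value (tr b))) ∈ El H
    bounded-trace∈H ideal (ℕ≼K , _) lim tr tr-trace γ =
      let γ′ , γ≺γ′ = lim γ
      in IsIdealOnPκ.isFine ideal
        ( (comp ｛ value γ′ ｝ , [ singleton≺ (value γ′) ])
        , λ b (γ≮tr , γ′∈b) → ∈comp⁻ γ≮tr
            (Equivalence.from (tr-trace b (value γ))
              (value γ′ , γ′∈b (∈comp⁺ refl) , holds {P = _< κ} γ′ , ≺⇒< K {γ} {γ′} γ≺γ′)))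
      where
      singleton≺ : ∀ ξ → ⟦ comp ｛ ξ ｝ ⟧ ≺ ∣ K ∣
      singleton≺ ξ =
          mk↣ {to = λ _ → γ} (λ {x} {y} _ → unique x y)
        -- An injection of κ into a singleton would compose with that of ℕ into κ and identify 0 and
        -- 1.
        , λ K≼ → 0≢1+n (Injection.injective (≼-trans ℕ≼K K≼) {0} {1} (unique _ _))
        where
        unique : (x y : ⟦ comp ｛ ξ ｝ ⟧) → x ≡ y
        unique (_ , p) (_ , q) = ⟦⟧-≡ (trans (sym (∈comp⁻ p)) (∈comp⁻ q))

-- The abstract argument applied to a colouring of pairs.

theorem14p1 : ExcludedMiddle 0ℓ → Extensionality 0ℓ 0ℓ →
    (Λ : Ordinal) → IsCardinal Λ →
    (κ : ∣ Λ ∣) → IsCardinal (Λ ↾ κ) →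
    IsUncountable (Λ ↾ κ) → IsRegular (Λ ↾ κ) → IsLimitCardinal (Λ ↾ κ) →
    (H : ℙ (ℙ (Pκ Λ κ))) → IsIdealOnPκ Λ κ H →
    (μ ν : Ordinal) → IsCof H μ → IsCovM (Λ ↾ κ) ν → ∣ μ ∣ ≺ ∣ ν ∣ →
    (κ⁺ : Ordinal) → IsCardinalSuccessor (Λ ↾ κ) κ⁺ →
    PartitionRelation Λ κ H κ⁺
theorem14p1 em ext Λ _ κ κ-card κ-unc κ-reg κ-lim H ideal μ ν cof covM μ≺ν κ⁺ succ F A A∈H⁺ =
  let c , avoidable = ∃-avoidable em ext (Λ ↾ κ) κ-card κ-lim isIdeal isComplete κ⁺ κ⁺⋠κ
                        R (λ {ξ} {b} → R-functional {ξ} {b}) A A∈H⁺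
      B , B∈H⁺ , B⊆A , avoids = ∃-avoiding em ext (Λ ↾ κ) κ-card κ-lim isIdeal isComplete κ⁺ κ⁺⋠κ
                        R (λ {ξ} {b} → R-functional {ξ} {b}) A A∈H⁺ c avoidable
                        (Injection.to (proj₁ κ-unc) 0) κ-reg tr
                        (bounded-trace∈H em Λ κ ideal κ-unc κ-lim tr tr-trace) μ ν cof covM μ≺ν
  in B , B∈H⁺ , B⊆A , λ all → missed B c avoids (all c)
  where
  open IsIdealOnPκ ideal using (isIdeal; isComplete)

  κ⁺⋠κ : ¬ (∣ κ⁺ ∣ ≼ ∣ Λ ↾ κ ∣)
  κ⁺⋠κ = proj₂ (IsCardinalSuccessor.greater succ)

  R : ∣ Λ ↾ κ ∣ → Pκ Λ κ → ∣ κ⁺ ∣ → Set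
  R ξ b c = ∃[ p ] value p ≡ (value ξ , b) × F p ≡ c

  R-functional : ∀ {ξ b c d} → R ξ b c → R ξ b d → c ≡ d
  R-functional (p , p≡ , Fp≡c) (q , q≡ , Fq≡d) =
    trans (sym Fp≡c) (trans (cong F (value-injective (trans p≡ (sym q≡)))) Fq≡d)

  tr : Pκ Λ κ → ∣ Λ ↾ κ ∣
  tr b = proj₁ (trace em Λ κ κ-reg b)

  tr-trace : ∀ b → IsTrace Λ κ b (value (tr b))
  tr-trace b = proj₂ (trace em Λ κ κ-reg b)

  missed : ∀ B c →
           (∀ {a b} → a ∈ El B → b ∈ El B → Ordinal._<_ (Λ ↾ κ) (tr a) (tr b) → ¬ R (tr a) b c) →
           ¬ Image Λ κ F B c
  missed B c avoids (p , (b∈B , a , a∈B , δ-trace , ε , ε-trace , δ<ε) , Fp≡c)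
    -- The pair carries its own traces; uniqueness identifies them with the values of `tr`.
    with trace-unique em Λ κ {a} δ-trace (tr-trace a)
       | trace-unique em Λ κ {proj₂ (value p)} ε-trace (tr-trace (proj₂ (value p)))
  ... | δ≡ | refl = avoids a∈B b∈B (subst (λ δ → Ordinal._<_ Λ δ ε) δ≡ δ<ε)
                      (p , cong (_, proj₂ (value p)) δ≡ , Fp≡c)
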